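{- NRAs and NRRAs are expressively incomparable: there is a data language that is definable by an NRA but not by any NRRA, and there is a data language that is definable by an NRRA but not by any NRA.
   Context: $\Sigma$ is a finite alphabet, $\mathbb{D}$ an infinite set of data values, $\Sigma^{\pm}=\Sigma\cup\{a^-\mid a\in\Sigma\}$. Automata are over $\Sigma^{\pm}$. Data paths. A data path over $\Sigma^{\pm}$ is a sequence $\alpha=d_0a_1d_1\dots a_nd_n$ ($n\ge 0$, $d_i\in\mathbb{D}$, $a_i\in\Sigma^{\pm}$). Its positions are $0,\dots,2n$; $d_i$ is at position $2i$ and $a_i$ at position $2i-1$. A data language is a set of data paths. NRA. For $k\in\mathbb{N}$, $[k]=\{1,\dots,k\}$; $\mathcal{C}_k$ is the set of constraints $c:=r_i\sim r_j\mid r_i\not\sim r_j\mid c\vee c\mid c\wedge c$, $0\le i,j\le k$, $i\ne j$, where $r_0$ stands for the current data value. For $\theta\in(\mathbb{D}\cup\{\bot\})^{[k]}$, $d\in\mathbb{D}$, put $\theta(0)=d$; $(\theta,d)\models r_i\sim r_j$ iff $\theta(i),\theta(j)\ne\bot$ and $\theta(i)=\theta(j)$; $\not\sim$ is the negation of $\sim$; $\vee,\wedge$ as usual. A nondeterministic $k$-register data path automaton (NRA) over $\Sigma^{\pm}$ is $(Q,k,\delta,I,F)$ with $Q=Q_w\cup Q_d$ finite disjoint, $I\subseteq Q_d$, $F\subseteq Q_w$, $\delta=\delta_w\cup\delta_d$ finite, $\delta_w\subseteq Q_w\times\Sigma^{\pm}\times Q_d$, $\delta_d\subseteq Q_d\times\mathcal{C}_k\times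 Q_w\times 2^{[k]}$. It reads $\alpha$ symbol by symbol from a state in $I$ with all registers $\bot$: on a word symbol $a$ it uses $(q,a,q')\in\delta_w$, leaving $\theta$ unchanged; on a data value $d$ it uses $(q,c,q',X)\in\delta_d$ with $(\theta,d)\models c$, and then assigns $d$ to every register in $X$. It accepts $\alpha$ if it can be in a state of $F$ after reading all of $\alpha$. Position terms over $\Sigma^{\pm}$: $t:=cur\mid suc(t)\mid pred(t)\mid suc_A(t)\mid pred_A(t)$, $\emptyset\ne A\subseteq\Sigma^{\pm}$. For $\alpha$ and an even position $2i$: $cur_\alpha[2i]=2i$; $(suc(cur))_\alpha[2i]=2(i+1)$ if $i<n$, else $\bot$ (undefined); $(pred(cur))_\alpha[2i]=2(i-1)$ if $i>0$, else $\bot$; $(suc_A(cur))_\alpha[2i]=2j$ for the least $j$ with $i<j\le n$, $a_j\in A$, and $\bot$ if none; $(pred_A(cur))_\alpha[2i]=2(j-1)$ for the largest $j$ with $1\le j\le i$, $a_j\in A$, and $\bot$ if none; $(op(t))_\alpha[2i]=(op(cur))_\alpha[t_\alpha[2i]]$ if $t_\alpha[2i]\ne\bot$, else $\bot$. Rigid data constraints: $c:=t_1\sim t_2\mid t_1\not\sim t_2\mid c\vee c\mid c\wedge c$; $(\alpha,2i)\models t_1\sim t_2$ iff $(t_1)_\alpha[2i],(t_2)_\alpha[2i]\ne\bot$ and the data values of $\alpha$ at these positions are equal; $\not\sim$ is the negation of $\sim$; $\vee,\wedge$ as usual. NRRA (nondeterministic rigid register automaton) over $\Sigma^{\pm}$: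 $(Q,\delta,I,F)$ with $Q=Q_w\cup Q_d$ finite disjoint, $I\subseteq Q_d$, $F\subseteq Q_w$, $\delta=\delta_w\cup\delta_d$ finite, $\delta_w\subseteq Q_w\times\Sigma^{\pm}\times Q_d$, $\delta_d$ consisting of triples $(q,c,q')$ with $q\in Q_d$, $q'\in Q_w$, $c$ a rigid data constraint. A run over $\alpha$ is $q_0c_0q_1a_1q_2\dots a_nq_{2n}c_nq_{2n+1}$ with $q_0\in I$, $(q_{2i},c_i,q_{2i+1})\in\delta_d$ and $(\alpha,2i)\models c_i$ for $0\le i\le n$, $(q_{2i-1},a_i,q_{2i})\in\delta_w$ for $1\le i\le n$; accepting if $q_{2n+1}\in F$. The data language defined is the set of data paths with an accepting run. -}

module Defs where

open import Data.Bool using (Bool; T; if_then_else_)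
open import Data.Fin using (Fin; zero; suc; inject₁; fromℕ; _≤_; _<_)
open import Data.Fin.Subset using (Subset) renaming (_∈_ to _∈ˢ_)
open import Data.List using (List)
open import Data.List.Membership.Propositional using (_∈_)
open import Data.Maybe using (Maybe; just; nothing)
open import Data.Nat using (ℕ; suc)
open import Data.Product using (∃-syntax; _×_; _,_)
open import Data.Sum using (_⊎_)
open import Data.Vec using (Vec; []; _∷_; lookup)
import Data.Vec.Functional as Vector
open import Function using (_↔_; _↣_)
open import Level using (0ℓ)
open import Relation.Binary.PropositionalEquality using (_≡_; _≢_)
open import Relation.Nullary using (¬_)
open import Relation.Unary using (Pred; _≐_)

-- Alphabets are nonempty.
IsAlphabet : Set → Set
IsAlphabet Σ = ∃[ m ] (Fin (suc m) ↔ Σ)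

Infinite : Set → Set
Infinite 𝔻 = ℕ ↣ 𝔻

module Automata (Σ 𝔻 : Set) where

  data Σ± : Set where
    _⁺ _⁻ : Σ → Σ±

  -- The path d₀ a₁ d₁ … aₙ dₙ has n = len, dᵢ = lookup values i, and
  -- aₗ₊₁ = lookup letters l, the letter between dₗ and dₗ₊₁.
  record DataPath : Set where
    constructor path
    field
      {len}   : ℕ
      letters : Vec Σ± len
      values  : Vec 𝔻 (suc len)

  open DataPath public

  DataLanguage : Set₁
  DataLanguage = Pred DataPath 0ℓ

  -- Index zero is r₀, the current data value; suc i is the i-th register.
  data RegConstraint (k : ℕ) : Set where
    eq neq  : (i j : Fin (suc k)) → i ≢ j → RegConstraint k
    _∨_ _∧_ : (c c′ : RegConstraint k) → RegConstraint k

  -- nothing is the empty register ⊥.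
  Registers : ℕ → Set
  Registers k = Fin k → Maybe 𝔻

  _∼ᵣ_ : Maybe 𝔻 → Maybe 𝔻 → Set
  x ∼ᵣ y = ∃[ d ] (x ≡ just d × y ≡ just d)

  _,_⊨ᵣ_ : ∀ {k} → Registers k → 𝔻 → RegConstraint k → Set
  θ , d ⊨ᵣ eq i j _  = (just d Vector.∷ θ) i ∼ᵣ (just d Vector.∷ θ) j
  θ , d ⊨ᵣ neq i j _ = ¬ ((just d Vector.∷ θ) i ∼ᵣ (just d Vector.∷ θ) j)
  θ , d ⊨ᵣ (c ∨ c′)  = (θ , d ⊨ᵣ c) ⊎ (θ , d ⊨ᵣ c′)
  θ , d ⊨ᵣ (c ∧ c′)  = (θ , d ⊨ᵣ c) × (θ , d ⊨ᵣ c′)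

  _[_≔_] : ∀ {k} → Registers k → Subset k → 𝔻 → Registers k
  (θ [ X ≔ d ]) i = if lookup X i then just d else θ i

  record NRA : Set where
    field
      {#w #d} : ℕ
      k       : ℕ

    Q-w : Set
    Q-w = Fin #w

    Q-d : Set
    Q-d = Fin #d

    field
      δ-w : List (Q-w × Σ± × Q-d)
      δ-d : List (Q-d × RegConstraint k × Q-w × Subset k)
      I   : Subset #d
      F   : Subset #w

  module _ (𝓐 : NRA) where
    open NRA 𝓐

    data AcceptsFrom : ∀ {n} → Q-d → Registers k → Vec Σ± n → Vec 𝔻 (suc n) → Set where
      last : ∀ {q c q′ X θ d} →
             (q , c , q′ , X) ∈ δ-d → θ , d ⊨ᵣ c → q′ ∈ˢ F →
             AcceptsFrom q θ [] (d ∷ [])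
      step : ∀ {n q c q′ X q″ θ d a} {w : Vec Σ± n} {v : Vec 𝔻 (suc n)} →
             (q , c , q′ , X) ∈ δ-d → θ , d ⊨ᵣ c →
             (q′ , a , q″) ∈ δ-w →
             AcceptsFrom q″ (θ [ X ≔ d ]) w v →
             AcceptsFrom q θ (a ∷ w) (d ∷ v)

    NRA-language : DataLanguage
    NRA-language α =
      ∃[ q ] (q ∈ˢ I × AcceptsFrom q (λ _ → nothing) (letters α) (values α))

  record Letters : Set where
    field
      member   : Σ± → Bool
      nonempty : ∃[ a ] T (member a)

  _∈ₗ_ : Σ± → Letters → Set
  a ∈ₗ A = T (Letters.member A a)

  data Term : Set where
    cur            : Term
    suc pred       : Term → Term
    suc[_] pred[_] : Letters → Term → Term

  -- The partial function i ↦ t[2i] is given by its graph: (⟦ t ⟧ w i p) says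
  -- that t is defined at position 2i of a path with letters w, with value 2p.
  ⟦_⟧ : Term → ∀ {n} → Vec Σ± n → Fin (suc n) → Fin (suc n) → Set
  ⟦ cur ⟧       w i p = p ≡ i
  ⟦ suc t ⟧     w i p = ∃[ j ] (⟦ t ⟧ w i j × ∃[ l ] (j ≡ inject₁ l × p ≡ suc l))
  ⟦ pred t ⟧    w i p = ∃[ j ] (⟦ t ⟧ w i j × ∃[ l ] (j ≡ suc l × p ≡ inject₁ l))
  -- The letter at l has number l + 1, so j ≤ l means j < l + 1 and
  -- l < j means l + 1 ≤ j.
  ⟦ suc[ A ] t ⟧ w i p = ∃[ j ] (⟦ t ⟧ w i j × ∃[ l ] (p ≡ suc l ×
    j ≤ l × lookup w l ∈ₗ A ×
    (∀ l′ → j ≤ l′ → l′ < l → ¬ (lookup w l′ ∈ₗ A))))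
  ⟦ pred[ A ] t ⟧ w i p = ∃[ j ] (⟦ t ⟧ w i j × ∃[ l ] (p ≡ inject₁ l ×
    l < j × lookup w l ∈ₗ A ×
    (∀ l′ → l < l′ → l′ < j → ¬ (lookup w l′ ∈ₗ A))))

  data RigidConstraint : Set where
    eq neq  : (t t′ : Term) → RigidConstraint
    _∨_ _∧_ : (c c′ : RigidConstraint) → RigidConstraint

  SameValue : (α : DataPath) → Fin (suc (len α)) → Term → Term → Set
  SameValue α i t t′ = ∃[ p ] ∃[ p′ ]
    (⟦ t ⟧ (letters α) i p × ⟦ t′ ⟧ (letters α) i p′ ×
     lookup (values α) p ≡ lookup (values α) p′)

  _,_⊨_ : (α : DataPath) → Fin (suc (len α)) → RigidConstraint → Set
  α , i ⊨ eq t t′  = SameValue α i t t′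
  α , i ⊨ neq t t′ = ¬ SameValue α i t t′
  α , i ⊨ (c ∨ c′) = (α , i ⊨ c) ⊎ (α , i ⊨ c′)
  α , i ⊨ (c ∧ c′) = (α , i ⊨ c) × (α , i ⊨ c′)

  record NRRA : Set where
    field
      {#w #d} : ℕ

    Q-w : Set
    Q-w = Fin #w

    Q-d : Set
    Q-d = Fin #d

    field
      δ-w : List (Q-w × Σ± × Q-d)
      δ-d : List (Q-d × RigidConstraint × Q-w)
      I   : Subset #d
      F   : Subset #w

  module _ (𝓡 : NRRA) where
    open NRRA 𝓡

    -- In the run q₀ c₀ q₁ a₁ q₂ … cₙ q₂ₙ₊₁, state-d i is q₂ᵢ and
    -- state-w i is q₂ᵢ₊₁.
    record AcceptingRun (α : DataPath) : Set where
      field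
        state-d    : Fin (suc (len α)) → Q-d
        constraint : Fin (suc (len α)) → RigidConstraint
        state-w    : Fin (suc (len α)) → Q-w
        initial    : state-d zero ∈ˢ I
        step-d     : ∀ i → (state-d i , constraint i , state-w i) ∈ δ-d
        satisfied  : ∀ i → α , i ⊨ constraint i
        step-w     : ∀ l → (state-w (inject₁ l) , lookup (letters α) l , state-d (suc l)) ∈ δ-w
        accepting  : state-w (fromℕ (len α)) ∈ˢ F

    NRRA-language : DataLanguage
    NRRA-language α = AcceptingRun α

  NRA-definable NRRA-definable : DataLanguage → Set
  NRA-definable  L = ∃[ 𝓐 ] (NRA-language 𝓐 ≐ L)
  NRRA-definable L = ∃[ 𝓡 ] (NRRA-language 𝓡 ≐ L)

{-# OPTIONS --safe #-}

-- On words over a single letter, a position term only reaches positions within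
-- its depth.  Hence an NRRA cannot notice that the first value of a long path
-- with distinct values is overwritten by its last value, whereas an NRA stores
-- the first value and compares.  Conversely, by testing cur ≁ suc[ A ] cur
-- everywhere, with A the inverse letters, an NRRA compares an unbounded number
-- of values with the one following the first letter of A.  On k + 1 distinct
-- values, an NRA with k registers has lost one of them at the end, and cannot
-- tell it from a fresh value.

module Submission where

open import Defs
open import Data.Bool using (true; false)
open import Data.Fin using (Fin; zero; suc; inject₁; fromℕ; fromℕ<; toℕ; _≤_; _≟_)
open import Data.Fin.Properties
  using (toℕ-injective; toℕ-inject₁; toℕ-fromℕ; toℕ-fromℕ<; toℕ<n; toℕ≤pred[n]; suc-injective;
         fromℕ≢inject₁; inject₁-injective; ≤fromℕ; any?; ¬∀⟶∃¬; <⇒notInjective)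
open import Data.Fin.Subset using (⊤; ⁅_⁆; inside; outside)
open import Data.Fin.Subset.Properties using (∈⊤; x∈⁅x⁆)
open import Data.List using ([]; _∷_; map)
open import Data.List.Extrema.Nat using (max; xs≤max)
open import Data.List.Membership.Propositional using (_∈_)
open import Data.List.Membership.Propositional.Properties using (∈-map⁺)
import Data.List.Relation.Unary.All as All
open import Data.List.Relation.Unary.Any using (here; there)
open import Data.Maybe using (Maybe; just; nothing)
open import Data.Maybe.Properties using (just-injective)
open import Data.Maybe.Relation.Unary.All using (just; nothing) renaming (All to Allᴹ)
open import Data.Nat as ℕ using (ℕ; zero; suc; _+_; _⊔_; ∣_-_∣; s≤s)
import Data.Nat.Properties as ℕ
open import Data.Product as Product using (∃-syntax; Σ-syntax; _×_; _,_; proj₁; proj₂)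
import Data.Sum as Sum
open import Data.Unit using (tt)
open import Data.Vec using (Vec; []; _∷_; lookup; replicate; tabulate; _[_]≔_)
open import Data.Vec.Properties
  using (lookup-replicate; lookup∘tabulate; lookup∘update; lookup∘update′)
open import Function using (_∘_; id; Injection; Inverse)
open import Function.Definitions using (Injective)
open import Relation.Binary.PropositionalEquality
  using (_≡_; _≢_; refl; sym; trans; cong; subst; subst₂)
open import Relation.Nullary using (¬_; contradiction; yes; no)

-- Pigeonhole, distances and local injectivity

-- Pigeonhole: if every element had a preimage, choosing preimages would inject `Fin (suc k)` into
-- `Fin k`.
∃-avoided : ∀ {k} (h : Fin k → Fin (suc k)) → ∃[ j ] (∀ r → h r ≢ j)
∃-avoided {k} h
  with j , j∉h ← ¬∀⟶∃¬ (suc k) (λ j → ∃[ r ] h r ≡ j) (λ j → any? λ r → h r ≟ j)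
    (λ surj → <⇒notInjective {f = proj₁ ∘ surj} (ℕ.n<1+n k)
      λ {i} {j} eq → trans (sym (proj₂ (surj i))) (trans (cong h eq) (proj₂ (surj j))))
  = j , λ r eq → j∉h (r , eq)

∣1+n-n∣≡1 : ∀ n → ∣ suc n - n ∣ ≡ 1
∣1+n-n∣≡1 zero    = refl
∣1+n-n∣≡1 (suc n) = ∣1+n-n∣≡1 n

∣-∣-step : ∀ i j p {d} → ∣ p - j ∣ ≡ 1 → ∣ j - i ∣ ℕ.≤ d → ∣ p - i ∣ ℕ.≤ suc d
∣-∣-step i j p p-j j-i = ℕ.≤-trans (ℕ.∣-∣-triangle p j i)
  (ℕ.+-mono-≤ (ℕ.≤-reflexive p-j) j-i)

tabulate-injective : ∀ {A : Set} {f : ℕ → A} → Injective _≡_ _≡_ f →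
                     ∀ n → Injective _≡_ _≡_ (lookup (tabulate {n = n} (f ∘ toℕ)))
tabulate-injective {f = f} f-inj n {i} {j} eq = toℕ-injective (f-inj
  (trans (sym (lookup∘tabulate (f ∘ toℕ) i)) (trans eq (lookup∘tabulate (f ∘ toℕ) j))))

-- Comparing values at distance at most `r` then amounts to comparing positions.
LocallyInjective : ∀ {A : Set} {n} → ℕ → Vec A n → Set
LocallyInjective r v =
  ∀ p p′ → ∣ toℕ p - toℕ p′ ∣ ℕ.≤ r → lookup v p ≡ lookup v p′ → p ≡ p′

first≔last : ∀ {A : Set} {n} → Vec A (suc n) → Vec A (suc n)
first≔last {n = n} v = v [ zero ]≔ lookup v (fromℕ n)

-- The only coincidence is between the first and the last position, which are `n` apart.
first≔last-locallyInjective :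
  ∀ {A : Set} {n r} (v : Vec A (suc n)) → Injective _≡_ _≡_ (lookup v) →
  r ℕ.< n → LocallyInjective r (first≔last v)
first≔last-locallyInjective {n = n} {r} (x ∷ xs) inj r<n = go
  where
  last≢ : ∀ (p : Fin n) → suc (toℕ p) ℕ.≤ r → lookup (x ∷ xs) (fromℕ n) ≢ lookup xs p
  last≢ p p<r eq = ℕ.<⇒≱ r<n (subst (ℕ._≤ r)
    (trans (sym (cong toℕ (inj {fromℕ n} {suc p} eq))) (toℕ-fromℕ n)) p<r)

  go : LocallyInjective r (first≔last (x ∷ xs))
  go zero    zero     _ _  = refl
  go zero    (suc p′) d eq = contradiction eq (last≢ p′ d)
  go (suc p) zero     d eq = contradiction (sym eq) (last≢ p d)
  go (suc p) (suc p′) _ eq = inj eq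

module _ {Σ 𝔻 : Set} where
  open Automata Σ 𝔻

  -- Rigid register automata see only a neighbourhood of each position

  -- `suc[ A ]` and `pred[ A ]` count as one step because over a word repeating a single letter they
  -- lead to an adjacent position or are undefined.
  depth : Term → ℕ
  depth cur            = 0
  depth (suc t)        = suc (depth t)
  depth (pred t)       = suc (depth t)
  depth (suc[ A ] t)   = suc (depth t)
  depth (pred[ A ] t)  = suc (depth t)

  radius : RigidConstraint → ℕ
  radius (eq t t′)  = depth t ⊔ depth t′
  radius (neq t t′) = depth t ⊔ depth t′
  radius (c ∨ c′)   = radius c ⊔ radius c′
  radius (c ∧ c′)   = radius c ⊔ radius c′

  ∈ₗ-replicate : ∀ {n b} {A : Letters} (l l′ : Fin n) →
                 lookup (replicate n b) l ∈ₗ A → lookup (replicate n b) l′ ∈ₗ A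
  ∈ₗ-replicate {b = b} {A} l l′ = subst (_∈ₗ A)
    (trans (lookup-replicate l b) (sym (lookup-replicate l′ b)))

  -- All letters are equal, so if one lies in `A`, the letter right after position `j` does too and
  -- the search stops there.
  nextIsAdjacent : ∀ {n b A} (j : Fin (suc n)) (l : Fin n) → j ≤ l →
    lookup (replicate n b) l ∈ₗ A →
    (∀ l′ → j ≤ l′ → toℕ l′ ℕ.< toℕ l → ¬ (lookup (replicate n b) l′ ∈ₗ A)) →
    toℕ l ≡ toℕ j
  nextIsAdjacent {n} {A = A} j l j≤l l∈A none with toℕ j ℕ.<? toℕ l
  ... | no  j≮l = ℕ.≤-antisym (ℕ.≮⇒≥ j≮l) j≤l
  ... | yes j<l = contradiction (∈ₗ-replicate {A = A} l l′ l∈A)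
    (none l′ (ℕ.≤-reflexive (sym l′≡j)) (subst (ℕ._< toℕ l) (sym l′≡j) j<l))
    where
    j<n : toℕ j ℕ.< n
    j<n = ℕ.<-trans j<l (toℕ<n l)
    l′ : Fin n
    l′ = fromℕ< j<n
    l′≡j : toℕ l′ ≡ toℕ j
    l′≡j = toℕ-fromℕ< j<n

  -- Otherwise the letter following `l` would be a later candidate before `j`, equal to the one at
  -- `l` and hence in `A`.
  previousIsAdjacent : ∀ {n b A} (j : Fin (suc n)) (l : Fin n) → toℕ l ℕ.< toℕ j →
    lookup (replicate n b) l ∈ₗ A →
    (∀ l′ → toℕ l ℕ.< toℕ l′ → toℕ l′ ℕ.< toℕ j → ¬ (lookup (replicate n b) l′ ∈ₗ A)) →
    suc (toℕ l) ≡ toℕ j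
  previousIsAdjacent {n} {A = A} j l l<j l∈A none with suc (toℕ l) ℕ.<? toℕ j
  ... | no  1+l≮j = ℕ.≤-antisym l<j (ℕ.≮⇒≥ 1+l≮j)
  ... | yes 1+l<j = contradiction (∈ₗ-replicate {A = A} l l′ l∈A)
    (none l′ (ℕ.≤-reflexive (sym l′≡1+l)) (subst (ℕ._< toℕ j) (sym l′≡1+l) 1+l<j))
    where
    1+l<n : suc (toℕ l) ℕ.< n
    1+l<n = ℕ.<-≤-trans 1+l<j (toℕ≤pred[n] j)
    l′ : Fin n
    l′ = fromℕ< 1+l<n
    l′≡1+l : toℕ l′ ≡ suc (toℕ l)
    l′≡1+l = toℕ-fromℕ< 1+l<n

  ∣⟦t⟧-i∣≤depth : ∀ t {n b} {i p : Fin (suc n)} →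
    ⟦ t ⟧ (replicate n b) i p → ∣ toℕ p - toℕ i ∣ ℕ.≤ depth t
  ∣⟦t⟧-i∣≤depth cur {i = i} refl = ℕ.≤-reflexive (ℕ.∣n-n∣≡0 (toℕ i))
  ∣⟦t⟧-i∣≤depth (suc t) {i = i} (j , t⇓j , l , refl , refl) =
    ∣-∣-step (toℕ i) (toℕ j) (suc (toℕ l))
      (trans (cong ∣ suc (toℕ l) -_∣ (toℕ-inject₁ l)) (∣1+n-n∣≡1 (toℕ l)))
      (∣⟦t⟧-i∣≤depth t t⇓j)
  ∣⟦t⟧-i∣≤depth (pred t) {i = i} (j , t⇓j , l , refl , refl) =
    ∣-∣-step (toℕ i) (toℕ j) (toℕ (inject₁ l))
      (trans (cong ∣_- suc (toℕ l) ∣ (toℕ-inject₁ l))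
        (trans (ℕ.∣-∣-comm (toℕ l) (suc (toℕ l))) (∣1+n-n∣≡1 (toℕ l))))
      (∣⟦t⟧-i∣≤depth t t⇓j)
  ∣⟦t⟧-i∣≤depth (suc[ A ] t) {i = i} (j , t⇓j , l , refl , j≤l , l∈A , none) =
    ∣-∣-step (toℕ i) (toℕ j) (suc (toℕ l))
      (trans (cong ∣ suc (toℕ l) -_∣ (sym (nextIsAdjacent {A = A} j l j≤l l∈A none)))
        (∣1+n-n∣≡1 (toℕ l)))
      (∣⟦t⟧-i∣≤depth t t⇓j)
  ∣⟦t⟧-i∣≤depth (pred[ A ] t) {i = i} (j , t⇓j , l , refl , l<j , l∈A , none) =
    ∣-∣-step (toℕ i) (toℕ j) (toℕ (inject₁ l))
      (subst₂ (λ x y → ∣ x - y ∣ ≡ 1) (sym (toℕ-inject₁ l))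
        (previousIsAdjacent {A = A} j l l<j l∈A none)
        (trans (ℕ.∣-∣-comm (toℕ l) (suc (toℕ l))) (∣1+n-n∣≡1 (toℕ l))))
      (∣⟦t⟧-i∣≤depth t t⇓j)

  -- Both positions lie within `r` of `i`, hence within `r + r` of each other. Equal values in `v`
  -- therefore force a single position, which has one value in `v′`.
  sameValue-transfer : ∀ {n b r} (v v′ : Vec 𝔻 (suc n)) →
    LocallyInjective (r + r) v → ∀ {i} t t′ → depth t ⊔ depth t′ ℕ.≤ r →
    SameValue (path (replicate n b) v) i t t′ →
    SameValue (path (replicate n b) v′) i t t′
  sameValue-transfer {r = r} v v′ inj {i} t t′ d≤r (p , p′ , t⇓p , t′⇓p′ , v≡) =
    p , p′ , t⇓p , t′⇓p′ , cong (lookup v′) (inj p p′ close v≡)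
    where
    close : ∣ toℕ p - toℕ p′ ∣ ℕ.≤ r + r
    close = ℕ.≤-trans (ℕ.∣-∣-triangle (toℕ p) (toℕ i) (toℕ p′)) (ℕ.+-mono-≤
      (ℕ.≤-trans (∣⟦t⟧-i∣≤depth t t⇓p) (ℕ.m⊔n≤o⇒m≤o _ _ d≤r))
      (ℕ.≤-trans (ℕ.≤-reflexive (ℕ.∣-∣-comm (toℕ i) (toℕ p′)))
        (ℕ.≤-trans (∣⟦t⟧-i∣≤depth t′ t′⇓p′) (ℕ.m⊔n≤o⇒n≤o _ _ d≤r))))

  ⊨-transfer : ∀ {n b r} (v v′ : Vec 𝔻 (suc n)) →
    LocallyInjective (r + r) v → LocallyInjective (r + r) v′ →
    ∀ {i} c → radius c ℕ.≤ r →
    path (replicate n b) v , i ⊨ c → path (replicate n b) v′ , i ⊨ c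
  ⊨-transfer v v′ inj inj′ (eq t t′)  d≤r = sameValue-transfer v v′ inj t t′ d≤r
  -- A negated atom needs the transfer from `v′` back to `v`, hence local injectivity of both.
  ⊨-transfer v v′ inj inj′ (neq t t′) d≤r ¬same = ¬same ∘ sameValue-transfer v′ v inj′ t t′ d≤r
  ⊨-transfer v v′ inj inj′ (c ∨ c′)   d≤r = Sum.map
    (⊨-transfer v v′ inj inj′ c (ℕ.m⊔n≤o⇒m≤o _ _ d≤r))
    (⊨-transfer v v′ inj inj′ c′ (ℕ.m⊔n≤o⇒n≤o _ _ d≤r))
  ⊨-transfer v v′ inj inj′ (c ∧ c′)   d≤r = Product.map
    (⊨-transfer v v′ inj inj′ c (ℕ.m⊔n≤o⇒m≤o _ _ d≤r))
    (⊨-transfer v v′ inj inj′ c′ (ℕ.m⊔n≤o⇒n≤o _ _ d≤r))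

  module _ (𝓡 : NRRA) where
    open NRRA 𝓡

    -- The transitions are finitely many, so one radius serves every constraint that a run can use.
    reach : ℕ
    reach = max 0 (map (λ (_ , c , _) → radius c) δ-d)

    radius≤reach : ∀ {q c q′} → (q , c , q′) ∈ δ-d → radius c ℕ.≤ reach
    radius≤reach ∈δ = All.lookup (xs≤max 0 _) (∈-map⁺ (λ (_ , c , _) → radius c) ∈δ)

    acceptingRun-transfer : ∀ {n b} (v v′ : Vec 𝔻 (suc n)) →
      LocallyInjective (reach + reach) v → LocallyInjective (reach + reach) v′ →
      AcceptingRun 𝓡 (path (replicate n b) v) → AcceptingRun 𝓡 (path (replicate n b) v′)
    acceptingRun-transfer v v′ inj inj′ run = record
      { state-d    = state-d
      ; constraint = constraint
      ; state-w    = state-w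
      ; initial    = initial
      ; step-d     = step-d
      ; satisfied  = λ i → ⊨-transfer v v′ inj inj′ (constraint i)
                       (radius≤reach (step-d i)) (satisfied i)
      ; step-w     = step-w
      ; accepting  = accepting
      }
      where open AcceptingRun run

  -- A language of an NRA that no NRRA defines

  module _ (a : Σ) where

    fresh stored : RegConstraint 1
    fresh  = neq zero (suc zero) λ ()
    stored = eq zero (suc zero) λ ()

    -- Accepts d₀ a d₁ … a dₙ iff dₙ occurs among d₀, …, dₙ₋₁, provided that
    -- equality of data values is decidable.
    repetition : NRA
    repetition = record
      { #w  = 2
      ; #d  = 1
      ; k   = 1
      ; δ-w = (zero , a ⁺ , zero) ∷ []
      ; δ-d = (zero , fresh  , zero     , inside ∷ [])
            ∷ (zero , fresh  , zero     , outside ∷ [])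
            ∷ (zero , stored , suc zero , outside ∷ [])
            ∷ []
      ; I   = ⊤
      ; F   = ⁅ suc zero ⁆
      }

    -- The register is kept to the end: `fresh` holds at the earlier values because they differ from
    -- the last, and `stored` holds at the last.
    repetition-acceptsStored : ∀ {n θ} (v : Vec 𝔻 (suc n)) →
      θ zero ≡ just (lookup v (fromℕ n)) →
      (∀ l → lookup v (inject₁ l) ≢ lookup v (fromℕ n)) →
      AcceptsFrom repetition zero θ (replicate n (a ⁺)) v
    repetition-acceptsStored (d ∷ []) θ≡d _ =
      last (there (there (here refl))) (d , refl , θ≡d) (x∈⁅x⁆ (suc zero))
    repetition-acceptsStored (d ∷ v@(_ ∷ _)) θ≡ v≢ =
      step (there (here refl))
        (λ { (_ , refl , θ≡d) → v≢ zero (just-injective (trans (sym θ≡d) θ≡)) })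
        (here refl)
        (repetition-acceptsStored v θ≡ (v≢ ∘ suc))

    repetition-accepts : ∀ {n} (v : Vec 𝔻 (suc (suc n))) → Injective _≡_ _≡_ (lookup v) →
      NRA-language repetition (path (replicate (suc n) (a ⁺)) (first≔last v))
    repetition-accepts (_ ∷ v) inj = zero , ∈⊤ ,
      -- The register is still empty, so `fresh` holds. The value stored here is also the last one.
      step (here refl) (λ { (_ , _ , ()) }) (here refl)
        (repetition-acceptsStored v refl λ l v≡ →
          fromℕ≢inject₁ (sym (suc-injective (inj {suc (inject₁ l)} {suc (fromℕ _)} v≡))))

    -- The hypothesis on `θ` is an invariant, since by distinctness a newly stored value does not
    -- recur. Hence `stored`, which guards the only way into the final state, never holds.
    repetition-rejectsDistinct : ∀ {n q θ} {w : Vec Σ± n} {v : Vec 𝔻 (suc n)} →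
      Injective _≡_ _≡_ (lookup v) → (∀ p → θ zero ≢ just (lookup v p)) →
      ¬ AcceptsFrom repetition q θ w v
    repetition-rejectsDistinct inj θ∉v (last (here refl) _ ())
    repetition-rejectsDistinct inj θ∉v (last (there (here refl)) _ ())
    repetition-rejectsDistinct inj θ∉v (last (there (there (here refl))) (_ , refl , θ≡d) _) =
      θ∉v zero θ≡d
    repetition-rejectsDistinct inj θ∉v (step (here refl) _ (here refl) acc) =
      repetition-rejectsDistinct (suc-injective ∘ inj)
        (λ p d≡ → contradiction (inj {zero} {suc p} (just-injective d≡)) λ ()) acc
    repetition-rejectsDistinct inj θ∉v (step (there (here refl)) _ (here refl) acc) =
      repetition-rejectsDistinct (suc-injective ∘ inj) (θ∉v ∘ suc) acc
    -- The final state has no outgoing word transition.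
    repetition-rejectsDistinct inj θ∉v (step (there (there (here refl))) _ (here ()) _)

    repetition-not-NRRA-definable : Infinite 𝔻 → ¬ NRRA-definable (NRA-language repetition)
    repetition-not-NRRA-definable inf (𝓡 , ⊆L , L⊆) =
      repetition-rejectsDistinct v-inj (λ _ ()) (proj₂ (proj₂ (⊆L distinct-accepted)))
      where
      open Injection inf using (to; injective)
      r = reach 𝓡
      -- The least distance beyond `r + r`, so that no constraint of `𝓡` compares the first value
      -- with the last.
      n = suc (r + r)
      v : Vec 𝔻 (suc n)
      v = tabulate (to ∘ toℕ)
      v-inj : Injective _≡_ _≡_ (lookup v)
      v-inj = tabulate-injective injective (suc n)
      distinct-accepted : NRRA-language 𝓡 (path (replicate n (a ⁺)) v)
      distinct-accepted = acceptingRun-transfer 𝓡 (first≔last v) v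
        (first≔last-locallyInjective v v-inj ℕ.≤-refl) (λ _ _ _ → v-inj)
        (L⊆ (repetition-accepts v v-inj))

  -- Register automata forget values

  -- Comparing `r₀` with a register fails for `x` and `y` alike, and comparing two registers ignores
  -- the current value.
  ⊨ᵣ-unstored : ∀ {k} {θ : Registers k} {x y} →
    (∀ r → θ r ≢ just x) → (∀ r → θ r ≢ just y) →
    ∀ c → θ , x ⊨ᵣ c → θ , y ⊨ᵣ c
  ⊨ᵣ-unstored x∉ y∉ (eq zero zero i≢j) _ = contradiction refl i≢j
  ⊨ᵣ-unstored x∉ y∉ (eq zero (suc j) _) (_ , refl , θj≡) = contradiction θj≡ (x∉ j)
  ⊨ᵣ-unstored x∉ y∉ (eq (suc i) zero _) (_ , θi≡ , refl) = contradiction θi≡ (x∉ i)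
  ⊨ᵣ-unstored x∉ y∉ (eq (suc i) (suc j) _) sat = sat
  ⊨ᵣ-unstored x∉ y∉ (neq zero zero i≢j) _ = contradiction refl i≢j
  ⊨ᵣ-unstored x∉ y∉ (neq zero (suc j) _) _ (_ , refl , θj≡) = y∉ j θj≡
  ⊨ᵣ-unstored x∉ y∉ (neq (suc i) zero _) _ (_ , θi≡ , refl) = y∉ i θi≡
  ⊨ᵣ-unstored x∉ y∉ (neq (suc i) (suc j) _) sat = sat
  ⊨ᵣ-unstored x∉ y∉ (c ∨ c′) = Sum.map (⊨ᵣ-unstored x∉ y∉ c) (⊨ᵣ-unstored x∉ y∉ c′)
  ⊨ᵣ-unstored x∉ y∉ (c ∧ c′) = Product.map (⊨ᵣ-unstored x∉ y∉ c) (⊨ᵣ-unstored x∉ y∉ c′)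

  assign-preserves : ∀ {P : 𝔻 → Set} {k} {θ : Registers k} X {d} → P d →
    (∀ r → Allᴹ P (θ r)) → ∀ r → Allᴹ P ((θ [ X ≔ d ]) r)
  assign-preserves X Pd Pθ r with lookup X r
  ... | true  = just Pd
  ... | false = Pθ r

  -- θ′ is the register content when the last value is read.
  replaceLast : ∀ (𝓐 : NRA) (P : 𝔻 → Set) {n q θ} {w : Vec Σ± n} {v : Vec 𝔻 (suc n)} →
    (∀ l → P (lookup v (inject₁ l))) → (∀ r → Allᴹ P (θ r)) →
    AcceptsFrom 𝓐 q θ w v →
    Σ[ θ′ ∈ Registers (NRA.k 𝓐) ] ((∀ r → Allᴹ P (θ′ r)) ×
      (∀ y → (∀ r → θ′ r ≢ just (lookup v (fromℕ n))) → (∀ r → θ′ r ≢ just y) →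
        AcceptsFrom 𝓐 q θ w (v [ fromℕ n ]≔ y)))
  replaceLast 𝓐 P {θ = θ} Pv Pθ (last {c = c} ∈δ sat ∈F) =
    θ , Pθ , λ _ x∉ y∉ → last ∈δ (⊨ᵣ-unstored x∉ y∉ c sat) ∈F
  replaceLast 𝓐 P Pv Pθ (step {X = X} ∈δ sat ∈δ′ acc)
    -- The value read in this step is not the last one, so it satisfies `P` and may be stored; the
    -- step itself is kept.
    with θ′ , Pθ′ , replace ← replaceLast 𝓐 P (Pv ∘ suc) (assign-preserves X (Pv zero) Pθ) acc
    = θ′ , Pθ′ , λ y x∉ y∉ → step ∈δ sat ∈δ′ (replace y x∉ y∉)

  -- Each of the `k` registers holds at most one of the `k + 1` distinct values.
  ∃-unstored : ∀ {k} {g : Fin (suc k) → 𝔻} → Injective _≡_ _≡_ g →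
    (θ : Registers k) → (∀ r → Allᴹ (λ d → ∃[ i ] d ≡ g i) (θ r)) →
    ∃[ j ] (∀ r → θ r ≢ just (g j))
  ∃-unstored {k} {g} g-inj θ Pθ = Product.map₂
    (λ index≢j r θr≡gj → index≢j r (index-unique (Pθ r) θr≡gj))
    (∃-avoided (λ r → index (Pθ r)))
    where
    index : ∀ {m} → Allᴹ (λ d → ∃[ i ] d ≡ g i) m → Fin (suc k)
    index (just (i , _)) = i
    -- An arbitrary choice: the `k` registers still occupy at most `k` indices.
    index nothing        = zero

    index-unique : ∀ {m j} (p : Allᴹ (λ d → ∃[ i ] d ≡ g i) m) → m ≡ just (g j) → index p ≡ j
    index-unique (just (_ , d≡)) refl = g-inj (sym d≡)

  -- A language of an NRRA that no NRA defines

  module _ (a : Σ) where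

    inverses : Letters
    inverses = record
      { member   = λ { (_ ⁺) → false ; (_ ⁻) → true }
      ; nonempty = a ⁻ , tt
      }

    -- Being a negation, it also holds where no inverse letter follows, in particular at the last
    -- position.
    differsFromNext : RigidConstraint
    differsFromNext = neq cur (suc[ inverses ] cur)

    avoidNext : NRRA
    avoidNext = record
      { #w  = 1
      ; #d  = 1
      ; δ-w = (zero , a ⁺ , zero) ∷ (zero , a ⁻ , zero) ∷ []
      ; δ-d = (zero , differsFromNext , zero) ∷ []
      ; I   = ⊤
      ; F   = ⊤
      }

    constraint-unique : ∀ {q c q′} → (q , c , q′) ∈ NRRA.δ-d avoidNext → c ≡ differsFromNext
    constraint-unique (here refl) = refl

    -- The only inverse letter comes last, so from each of the first `k + 1` data positions
    -- `suc[ inverses ] cur` denotes the last one.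
    word : ∀ k → Vec Σ± (suc k)
    word k = replicate (suc k) (a ⁺) [ fromℕ k ]≔ a ⁻

    word-letters : ∀ k l → (Fin.zero {0} , lookup (word k) l , Fin.zero {0}) ∈ NRRA.δ-w avoidNext
    word-letters zero    zero    = there (here refl)
    word-letters (suc k) zero    = here refl
    word-letters (suc k) (suc l) = word-letters k l

    avoidNext-accepts : ∀ {k} (v : Vec 𝔻 (suc (suc k))) → Injective _≡_ _≡_ (lookup v) →
      NRRA-language avoidNext (path (word k) v)
    avoidNext-accepts {k} v v-inj = record
      { state-d    = λ _ → zero
      ; constraint = λ _ → differsFromNext
      ; state-w    = λ _ → zero
      ; initial    = ∈⊤
      ; step-d     = λ _ → here refl
      ; satisfied  = satisfied
      ; step-w     = word-letters k
      ; accepting  = ∈⊤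
      }
      where
      satisfied : ∀ i → path (word k) v , i ⊨ differsFromNext
      satisfied i (_ , _ , refl , (_ , refl , l , refl , i≤l , _) , v≡) =
        -- Equal values would make the two positions equal, but `suc[ inverses ]` moves strictly to
        -- the right.
        ℕ.<-irrefl (cong toℕ (v-inj v≡)) (s≤s i≤l)

    avoidNext-rejects : ∀ {k} (v : Vec 𝔻 (suc (suc k))) j →
      lookup v (inject₁ j) ≡ lookup v (fromℕ (suc k)) →
      ¬ NRRA-language avoidNext (path (word k) v)
    avoidNext-rejects {k} v j v≡ run =
      subst (_ , inject₁ j ⊨_) (constraint-unique (step-d (inject₁ j))) (satisfied (inject₁ j))
        (inject₁ j , fromℕ (suc k) , refl ,
         (inject₁ j , refl , fromℕ k , refl , j≤k , last∈ , earlier∉) , v≡)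
      where
      open AcceptingRun run using (step-d; satisfied)
      _∈inverses : Σ± → Set
      _∈inverses = _∈ₗ inverses
      j≤k : inject₁ j ≤ fromℕ k
      j≤k = subst (ℕ._≤ toℕ (fromℕ k)) (sym (toℕ-inject₁ j)) (≤fromℕ j)
      last∈ : lookup (word k) (fromℕ k) ∈inverses
      last∈ = subst _∈inverses (sym (lookup∘update (fromℕ k) (replicate (suc k) (a ⁺)) (a ⁻))) tt
      earlier∉ : ∀ l → inject₁ j ≤ l → toℕ l ℕ.< toℕ (fromℕ k) → ¬ (lookup (word k) l ∈inverses)
      earlier∉ l _ l<k = subst _∈inverses
        (trans (lookup∘update′ {i = l} {fromℕ k} (λ { refl → ℕ.<-irrefl refl l<k })
          (replicate (suc k) (a ⁺)) (a ⁻))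
          (lookup-replicate l (a ⁺)))

    avoidNext-not-NRA-definable : Infinite 𝔻 → ¬ NRA-definable (NRRA-language avoidNext)
    avoidNext-not-NRA-definable inf (𝓐 , ⊆L , L⊆) =
      avoidNext-rejects (v [ fromℕ (suc k) ]≔ y) j repeated
        (⊆L (_ , proj₁ (proj₂ run) , replace y x∉ y∉))
      where
      open Injection inf using (to; injective)
      k = NRA.k 𝓐
      v : Vec 𝔻 (suc (suc k))
      v = tabulate (to ∘ toℕ)
      v-inj : Injective _≡_ _≡_ (lookup v)
      v-inj = tabulate-injective injective (suc (suc k))
      -- The `k + 1` values before the last, one more than the registers can hold.
      g : Fin (suc k) → 𝔻
      g = lookup v ∘ inject₁
      P : 𝔻 → Set
      P d = ∃[ i ] d ≡ g i
      run = L⊆ (avoidNext-accepts v v-inj)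
      final = replaceLast 𝓐 P {v = v} (λ l → l , refl) (λ _ → nothing)
        (proj₂ (proj₂ run))
      θ = proj₁ final
      replace = proj₂ (proj₂ final)
      unstored = ∃-unstored {g = g} (inject₁-injective ∘ v-inj) θ (proj₁ (proj₂ final))
      j = proj₁ unstored
      y = g j
      y∉ = proj₂ unstored
      x∉ : ∀ r → θ r ≢ just (lookup v (fromℕ (suc k)))
      -- Before the last value is read, registers hold only earlier values, all distinct from it.
      x∉ r v≡ with just (i , x≡gi) ← subst (Allᴹ P) v≡ (proj₁ (proj₂ final) r) =
        fromℕ≢inject₁ {i = i} (v-inj x≡gi)
      repeated : lookup (v [ fromℕ (suc k) ]≔ y) (inject₁ j) ≡
                 lookup (v [ fromℕ (suc k) ]≔ y) (fromℕ (suc k))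
      repeated = trans (lookup∘update′ {i = inject₁ j} (fromℕ≢inject₁ ∘ sym) v y)
        (sym (lookup∘update (fromℕ (suc k)) v y))

proposition2 : (Σ 𝔻 : Set) → IsAlphabet Σ → Infinite 𝔻 →
    let open Automata Σ 𝔻 in
    (∃[ L ] (NRA-definable L × ¬ NRRA-definable L)) ×
    (∃[ L ] (NRRA-definable L × ¬ NRA-definable L))
proposition2 Σ 𝔻 (_ , Fin↔Σ) inf =
    -- Each witness is the language of the automaton itself, so its definability is immediate.
    (_ , (repetition a , id , id) , repetition-not-NRRA-definable a inf)
  , (_ , (avoidNext a , id , id) , avoidNext-not-NRA-definable a inf)
  where
  open Automata Σ 𝔻
  a = Inverse.to Fin↔Σ zero
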